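{- Let $n$ be a positive integer and let $\mathscr{H}=(\mathscr{V},\mathscr{E})$ be a linear $n$-uniform hypergraph with exactly $n$ edges. If $\mathscr{H}$ is weakly dense, i.e. for every integer $k$ with $2\le k<\sqrt{n}$ there are at most $k^2$ vertices of $\mathscr{H}$ of degree $k$, then $\chi(\mathscr{H})=n$.
   Context: A hypergraph $\mathscr{H}$ is a pair $(\mathscr{V},\mathscr{E})$, where $\mathscr{E}$ is a finite family of nonempty sets (the edges) and $\mathscr{V}=\bigcup_{E\in\mathscr{E}}E$ (the vertices). $\mathscr{H}$ is linear if any two distinct edges share at most one vertex, and $n$-uniform if each edge has exactly $n$ vertices. The degree $d(v)$ of a vertex $v$ is the number of edges containing $v$. A hypergraph with $n$ edges is weakly dense if no integer $k$ in the half-open interval $[2,\sqrt{n})$ is the degree of more than $k^2$ vertices. A $k$-coloring of $\mathscr{H}$ is a function $f:\mathscr{V}\to\{0,\ldots,k-1\}$ such that $f(v)\ne f(v')$ whenever $v\neq v'$ are vertices belonging to a common edge. The chromatic number $\chi(\mathscr{H})$ is the smallest $k$ for which a $k$-coloring of $\mathscr{H}$ exists. -}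

module Defs where

open import Data.Nat using (ℕ; _≤_; _<_; _^_; _≟_)
open import Data.Fin using (Fin)
open import Data.Fin.Subset using (Subset; _∈_; _∩_; ∣_∣; Nonempty)
open import Data.Fin.Subset.Properties using (_∈?_)
open import Data.Product using (∃; _×_)
open import Data.Vec using (allFin; count)
open import Function.Definitions using (Injective)
open import Relation.Binary.PropositionalEquality using (_≡_; _≢_)

-- All edges are finite, hence so is their union, and the vertices may be
-- numbered: they are Fin #V.  The set of edges is enumerated without
-- repetition by Fin #E; `covers` says that the vertex set is no larger than
-- the union of the edges.
record Hypergraph : Set where
  field
    #V        : ℕ
    #E        : ℕ
    edge      : Fin #E → Subset #V
    nonempty  : ∀ e → Nonempty (edge e)
    distinct  : Injective _≡_ _≡_ edge
    covers    : ∀ v → ∃ λ e → v ∈ edge e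

  degree : Fin #V → ℕ
  degree v = count (λ e → v ∈? edge e) (allFin #E)

  #ofDegree : ℕ → ℕ
  #ofDegree k = count (λ v → degree v ≟ k) (allFin #V)

open Hypergraph public using (#E)

module _ (H : Hypergraph) where
  open Hypergraph H hiding (#E)

  Linear : Set
  Linear = ∀ e e′ → edge e ≢ edge e′ → ∣ edge e ∩ edge e′ ∣ ≤ 1

  Uniform : ℕ → Set
  Uniform n = ∀ e → ∣ edge e ∣ ≡ n

  -- For a natural number k, k < √ n is expressed as k ^ 2 < n.
  WeaklyDense : Set
  WeaklyDense = ∀ k → 2 ≤ k → k ^ 2 < #E H → #ofDegree k ≤ k ^ 2

  IsColoring : (k : ℕ) → (Fin #V → Fin k) → Set
  IsColoring k f =
    ∀ v v′ → v ≢ v′ → ∀ e → v ∈ edge e → v′ ∈ edge e → f v ≢ f v′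

  Colorable : ℕ → Set
  Colorable k = ∃ (IsColoring k)

  -- χ(H) = k, as a relation: k is the least number of colors that suffices.
  HasChromaticNumber : ℕ → Set
  HasChromaticNumber k = Colorable k × (∀ j → Colorable j → k ≤ j)

{-# OPTIONS --safe #-}

-- Color the vertices greedily by decreasing degree.  Let v have degree k, and
-- let g be the number of its neighbors of degree at least k, g₌ of them of
-- degree exactly k.  Counting the pairs of edges e ∋ v and f ∌ v that share a
-- vertex gives g (k − 1) ≤ k (n − k) and g k ≤ k (n − k) + g₌.  If g ≥ n, the
-- first inequality forces k² ≤ n and the second g₌ ≥ k²; as v itself has degree
-- k, weak density leaves only k² = n.  Equality then holds throughout, so that
-- every edge through such a bad vertex meets every other edge in a vertex of
-- degree k.  If some vertex w of degree k is not bad, the vertices of degree k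
-- are colored in order of decreasing distance to w.  If all of them are bad,
-- they are the lines of an affine plane of order k whose points are the edges;
-- they are colored by their parallel classes, and no vertex has larger degree.
module Submission where

open import Algebra.Properties.Semiring.Sum using ()
open import Data.Bool using (if_then_else_)
open import Data.Empty using (⊥)
open import Data.Fin using (Fin; zero; suc; toℕ; fromℕ<)
open import Data.Fin.Properties using (any?; toℕ<n; toℕ-injective) renaming (_≟_ to _≟ᶠ_; suc-injective to suc-injectiveᶠ)
open import Data.Fin.Subset using (Subset; _∈_; _∩_; ∣_∣; inside; outside)
open import Data.Fin.Subset.Properties using (_∈?_; x∈p∩q⁺)
open import Data.Nat using (ℕ; zero; suc; pred; _+_; _*_; _^_; _≤_; _<_; z≤n; s≤s; _≟_; _≤?_; _<?_; NonZero; >-nonZero; >-nonZero⁻¹)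
open import Data.Nat.Properties
open import Data.Nat.Tactic.RingSolver using (solve-∀)
open import Data.Product using (∃; _×_; _,_; proj₁; proj₂)
open import Data.Sum using (_⊎_; inj₁; inj₂)
import Data.Vec as Vec
open import Function using (_∘_; id; case_of_)
open import Relation.Binary.PropositionalEquality
  using (_≡_; _≢_; refl; sym; trans; cong; cong₂; subst; subst₂; module ≡-Reasoning)
open import Relation.Nullary using (¬_; Dec; does; yes; no; ¬?; _×-dec_; _⊎-dec_; contradiction)
open import Relation.Nullary.Decidable using (decidable-stable)
open import Relation.Unary using (Pred; Decidable)
import Relation.Binary as B
open import Defs

open Algebra.Properties.Semiring.Sum +-*-semiring
  using (sum; sum-cong-≗; ∑-distrib-+; ∑-comm; *-distribˡ-sum; *-distribʳ-sum)

private variable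
  m n : ℕ

-- Finite sums of natural numbers

sum-mono-≤ : {f g : Fin n → ℕ} → (∀ i → f i ≤ g i) → sum f ≤ sum g
sum-mono-≤ {zero}  f≤g = z≤n
sum-mono-≤ {suc n} f≤g = +-mono-≤ (f≤g zero) (sum-mono-≤ (f≤g ∘ suc))

sum-mono-< : {f g : Fin n → ℕ} → (∀ i → f i ≤ g i) → ∀ i → f i < g i → sum f < sum g
sum-mono-< f≤g zero    fi<gi = +-mono-<-≤ fi<gi (sum-mono-≤ (f≤g ∘ suc))
sum-mono-< f≤g (suc i) fi<gi = +-mono-≤-< (f≤g zero) (sum-mono-< (f≤g ∘ suc) i fi<gi)

sum-squeeze : {f g : Fin n → ℕ} → (∀ i → f i ≤ g i) → sum g ≤ sum f → ∀ i → g i ≤ f i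
sum-squeeze f≤g Σg≤Σf i = ≮⇒≥ λ fi<gi → <⇒≱ (sum-mono-< f≤g i fi<gi) Σg≤Σf

sum-ones : ∀ n → sum {n} (λ _ → 1) ≡ n
sum-ones zero    = refl
sum-ones (suc n) = cong suc (sum-ones n)

term≤sum : (f : Fin n → ℕ) → ∀ i → f i ≤ sum f
term≤sum f zero    = m≤m+n _ _
term≤sum f (suc i) = ≤-trans (term≤sum (f ∘ suc) i) (m≤n+m _ _)

two-terms≤sum : (f : Fin n → ℕ) → ∀ {i j} → i ≢ j → f i + f j ≤ sum f
two-terms≤sum f {zero}  {zero}  i≢j = contradiction refl i≢j
two-terms≤sum f {zero}  {suc j} i≢j = +-monoʳ-≤ (f zero) (term≤sum (f ∘ suc) j)
two-terms≤sum f {suc i} {zero}  i≢j =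
  ≤-trans (≤-reflexive (+-comm (f (suc i)) _)) (+-monoʳ-≤ (f zero) (term≤sum (f ∘ suc) i))
two-terms≤sum f {suc i} {suc j} i≢j =
  ≤-trans (two-terms≤sum (f ∘ suc) (i≢j ∘ cong suc)) (m≤n+m _ _)

sum-positive : (f : Fin n → ℕ) → 0 < sum f → ∃ λ i → 0 < f i
sum-positive {suc n} f 0<Σ with f zero in eq
... | suc _ = zero , ≤-trans (s≤s z≤n) (≤-reflexive (sym eq))
... | zero  = let i , 0<fi = sum-positive (f ∘ suc) 0<Σ in suc i , 0<fi

sum≤1 : (f : Fin n → ℕ) → (∀ i → f i ≤ 1) → (∀ i j → 0 < f i → 0 < f j → i ≡ j) → sum f ≤ 1
sum≤1 {zero}  f f≤1 unique = z≤n
sum≤1 {suc n} f f≤1 unique with 0 <? f zero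
... | yes 0<f₀ = +-mono-≤ (f≤1 zero) (≮⇒≥ (none ∘ sum-positive (f ∘ suc)))
  where
  none : ¬ ∃ λ i → 0 < f (suc i)
  none (i , 0<fi) with () ← unique zero (suc i) 0<f₀ 0<fi
... | no  f₀≯0 = +-mono-≤ (≮⇒≥ f₀≯0)
  (sum≤1 (f ∘ suc) (f≤1 ∘ suc) λ i j 0<fi 0<fj → suc-injectiveᶠ (unique _ _ 0<fi 0<fj))

sum-*-sum : (f : Fin m → ℕ) (g : Fin n → ℕ) → sum f * sum g ≡ sum λ i → sum λ j → f i * g j
sum-*-sum f g = trans (*-distribʳ-sum (sum g) f) (sum-cong-≗ λ i → *-distribˡ-sum (f i) g)

0<* : ∀ {a b} → 0 < a * b → 0 < a × 0 < b
0<* {suc a} {zero}  p = contradiction p (subst (λ x → ¬ 0 < x) (sym (*-zeroʳ a)) λ ())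
0<* {suc a} {suc b} p = s≤s z≤n , s≤s z≤n

-- Indicators of decidable propositions, and counting

𝟙 : ∀ {p} {P : Set p} → Dec P → ℕ
𝟙 P? = if does P? then 1 else 0

module _ {p} {P : Set p} where

  𝟙≤1 : (P? : Dec P) → 𝟙 P? ≤ 1
  𝟙≤1 (yes _) = ≤-refl
  𝟙≤1 (no  _) = z≤n

  𝟙-yes : (P? : Dec P) → P → 𝟙 P? ≡ 1
  𝟙-yes (yes _) _ = refl
  𝟙-yes (no ¬p) p = contradiction p ¬p

  𝟙-no : (P? : Dec P) → ¬ P → 𝟙 P? ≡ 0
  𝟙-no (yes p) ¬p = contradiction p ¬p
  𝟙-no (no  _) _  = refl

  𝟙-positive : (P? : Dec P) → 0 < 𝟙 P? → P
  𝟙-positive (yes p) _ = p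

  𝟙-+-¬ : (P? : Dec P) → 𝟙 P? + 𝟙 (¬? P?) ≡ 1
  𝟙-+-¬ (yes _) = refl
  𝟙-+-¬ (no  _) = refl

  𝟙-≤ : (P? : Dec P) {x : ℕ} → (P → 1 ≤ x) → 𝟙 P? ≤ x
  𝟙-≤ (yes p) 1≤x = 1≤x p
  𝟙-≤ (no  _) _   = z≤n

  𝟙-*-≤ : (P? : Dec P) {x y : ℕ} → (P → x ≤ y) → 𝟙 P? * x ≤ y
  𝟙-*-≤ (yes p) x≤y = ≤-trans (≤-reflexive (+-identityʳ _)) (x≤y p)
  𝟙-*-≤ (no  _) _   = z≤n

module _ {p q} {P : Set p} {Q : Set q} (P? : Dec P) (Q? : Dec Q) where

  𝟙-mono : (P → Q) → 𝟙 P? ≤ 𝟙 Q?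
  𝟙-mono f = 𝟙-≤ P? λ p → ≤-reflexive (sym (𝟙-yes Q? (f p)))

  𝟙-< : ¬ P → Q → 𝟙 P? < 𝟙 Q?
  𝟙-< ¬p q = subst₂ _<_ (sym (𝟙-no P? ¬p)) (sym (𝟙-yes Q? q)) ≤-refl

𝟙-* : ∀ {p q} {P : Set p} {Q : Set q} (P? : Dec P) (Q? : Dec Q) →
      𝟙 P? * 𝟙 Q? ≡ 𝟙 (P? ×-dec Q?)
𝟙-* (yes _) Q? = +-identityʳ _
𝟙-* (no  _) Q? = refl

# : ∀ {p} {P : Pred (Fin n) p} → Decidable P → ℕ
# P? = sum λ i → 𝟙 (P? i)

#-single : (i : Fin n) → # (_≟ᶠ i) ≡ 1
#-single i = ≤-antisym
  (sum≤1 _ (λ j → 𝟙≤1 (j ≟ᶠ i)) λ j k p q → trans (𝟙-positive (j ≟ᶠ i) p) (sym (𝟙-positive (k ≟ᶠ i) q)))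
  (≤-trans (≤-reflexive (sym (𝟙-yes (i ≟ᶠ i) refl))) (term≤sum _ i))

count≡# : ∀ {a p} {A : Set a} {P : Pred A p} (P? : Decidable P) (g : Fin n → A) →
          Vec.count P? (Vec.tabulate g) ≡ # (P? ∘ g)
count≡# {zero}  P? g = refl
count≡# {suc n} P? g with P? (g zero)
... | yes _ = cong suc (count≡# P? (g ∘ suc))
... | no  _ = count≡# P? (g ∘ suc)

∣_∣≡# : (S : Subset n) → ∣ S ∣ ≡ # (_∈? S)
∣ Vec.[] ∣≡#            = refl
∣ inside  Vec.∷ S ∣≡# = cong suc ∣ S ∣≡#
∣ outside Vec.∷ S ∣≡# = ∣ S ∣≡#

-- Greedy coloring

-- Pairs of a vertex satisfying `Q` and its color are counted in two ways: if all `k` colors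
-- occurred there would be at least `k` pairs, but each vertex contributes at most one.
freeColor : ∀ {k p} {Q : Pred (Fin n) p} (Q? : Decidable Q) (c : Fin n → Fin k) →
            # Q? < k → ∃ λ a → ∀ u → Q u → c u ≢ a
freeColor {k = k} Q? c #Q<k with any? (λ a → ¬? (any? (λ u → Q? u ×-dec c u ≟ᶠ a)))
... | yes (a , free) = a , λ u Qu cu≡a → free (u , Qu , cu≡a)
... | no  none       = contradiction #Q<k (≤⇒≯ (begin
  k                                              ≡⟨ sum-ones k ⟨
  sum {k} (λ _ → 1)                              ≤⟨ sum-mono-≤ used ⟩
  sum (λ a → sum λ u → 𝟙 (Q? u ×-dec c u ≟ᶠ a))  ≡⟨ ∑-comm (λ a u → 𝟙 (Q? u ×-dec c u ≟ᶠ a)) ⟩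
  sum (λ u → sum λ a → 𝟙 (Q? u ×-dec c u ≟ᶠ a))  ≤⟨ sum-mono-≤ once ⟩
  # Q?                                           ∎))
  where
  open ≤-Reasoning
  used : ∀ a → 1 ≤ sum λ u → 𝟙 (Q? u ×-dec c u ≟ᶠ a)
  used a with any? (λ u → Q? u ×-dec c u ≟ᶠ a)
  ... | yes (u , h) = ≤-trans (≤-reflexive (sym (𝟙-yes (Q? u ×-dec c u ≟ᶠ a) h))) (term≤sum _ u)
  ... | no  ¬h      = contradiction (a , ¬h) none
  once : ∀ u → sum (λ a → 𝟙 (Q? u ×-dec c u ≟ᶠ a)) ≤ 𝟙 (Q? u)
  once u = begin
    sum (λ a → 𝟙 (Q? u ×-dec c u ≟ᶠ a))   ≡⟨ sum-cong-≗ (λ a → 𝟙-* (Q? u) (c u ≟ᶠ a)) ⟨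
    sum (λ a → 𝟙 (Q? u) * 𝟙 (c u ≟ᶠ a))   ≡⟨ *-distribˡ-sum (𝟙 (Q? u)) (λ a → 𝟙 (c u ≟ᶠ a)) ⟨
    𝟙 (Q? u) * # (c u ≟ᶠ_)                ≤⟨ *-monoʳ-≤ (𝟙 (Q? u)) (sum≤1 _ (λ a → 𝟙≤1 (c u ≟ᶠ a))
                                               λ a b p q → trans (sym (𝟙-positive (c u ≟ᶠ a) p))
                                                                 (𝟙-positive (c u ≟ᶠ b) q)) ⟩
    𝟙 (Q? u) * 1                          ≡⟨ *-identityʳ _ ⟩
    𝟙 (Q? u)                              ∎

bounded : (f : Fin n → ℕ) → ∃ λ M → ∀ i → f i < M
bounded f = suc (sum f) , λ i → s≤s (term≤sum f i)

module Greedy {V k : ℕ} {R : Fin V → Fin V → Set} (R? : B.Decidable R)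
              (R-sym : ∀ {u v} → R u v → R v u) (R-irrefl : ∀ {v} → ¬ R v v) where

  ProperOn : Pred (Fin V) _ → (Fin V → Fin k) → Set
  ProperOn S c = ∀ {u v} → S u → S v → R u v → c u ≢ c v

  extend : {S : Pred (Fin V) _} (S? : Decidable S) {c : Fin V → Fin k} → ProperOn S c →
           ∀ v → # (λ u → R? v u ×-dec S? u) < k →
           ∃ (ProperOn λ u → u ≡ v ⊎ S u)
  extend {S} S? {c} proper v few = recolor , proper′
    where
    a    = proj₁ (freeColor (λ u → R? v u ×-dec S? u) c few)
    free = proj₂ (freeColor (λ u → R? v u ×-dec S? u) c few)
    recolor : Fin V → Fin k
    recolor u = if does (u ≟ᶠ v) then a else c u
    proper′ : ProperOn (λ u → u ≡ v ⊎ S u) recolor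
    proper′ {x} {y} Sx Sy Rxy with x ≟ᶠ v | y ≟ᶠ v | Sx | Sy
    ... | yes refl | yes refl | _       | _       = contradiction Rxy R-irrefl
    ... | yes refl | no  y≢v  | _       | inj₁ eq = contradiction eq y≢v
    ... | yes refl | no  y≢v  | _       | inj₂ Sy = λ eq → free y (Rxy , Sy) (sym eq)
    ... | no  x≢v  | _        | inj₁ eq | _       = contradiction eq x≢v
    ... | no  x≢v  | yes refl | inj₂ Sx | _       = free x (R-sym Rxy , Sx)
    ... | no  x≢v  | no  y≢v  | _       | inj₁ eq = contradiction eq y≢v
    ... | no  x≢v  | no  y≢v  | inj₂ Sx | inj₂ Sy = proper Sx Sy Rxy

  -- The vertices of `P` keep their colors from `c₀`; the others are colored by decreasing `r`.
  -- Since `few` counts every neighbor tied in rank, ties may be broken arbitrarily.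
  module _ {P : Pred (Fin V) _} (P? : Decidable P) (c₀ : Fin V → Fin k) (proper₀ : ProperOn P c₀)
           (r : Fin V → ℕ)
           (few : ∀ v → ¬ P v → # (λ u → R? v u ×-dec (P? u ⊎-dec r v ≤? r u)) < k) where

    -- r with ties broken by the index of the vertex
    s : Fin V → ℕ
    s v = r v * V + toℕ v

    s-mono : ∀ {u v} → r u < r v → s u < s v
    s-mono {u} {v} ru<rv = begin-strict
      r u * V + toℕ u  <⟨ +-monoʳ-< (r u * V) (toℕ<n u) ⟩
      r u * V + V      ≡⟨ +-comm (r u * V) V ⟩
      suc (r u) * V    ≤⟨ *-monoˡ-≤ V ru<rv ⟩
      r v * V          ≤⟨ m≤m+n _ _ ⟩
      s v              ∎
      where open ≤-Reasoning

    s-reflects-≤ : ∀ {u v} → s u ≤ s v → r u ≤ r v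
    s-reflects-≤ su≤sv = ≮⇒≥ λ rv<ru → <⇒≱ (s-mono rv<ru) su≤sv

    s-injective : ∀ {u v} → s u ≡ s v → u ≡ v
    s-injective {u} {v} eq = toℕ-injective (+-cancelˡ-≡ (r u * V) _ _ (trans eq (cong (λ x → x * V + toℕ v) (sym ru≡rv))))
      where
      ru≡rv : r u ≡ r v
      ru≡rv = ≤-antisym (s-reflects-≤ (≤-reflexive eq)) (s-reflects-≤ (≤-reflexive (sym eq)))

    M = proj₁ (bounded s)

    -- The threshold `t′` descends from `M`, above all values of `s`, where only `P` is colored. As
    -- `s` is injective, each unit step colors at most one further vertex.
    colorDownTo : ∀ t t′ → t + t′ ≡ M → ∃ (ProperOn λ u → P u ⊎ t′ ≤ s u)
    colorDownTo zero    t′ refl = c₀ , λ where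
      (inj₁ Pu) (inj₁ Pv) → proper₀ Pu Pv
      {u} (inj₂ M≤su) _ → contradiction (proj₂ (bounded s) u) (≤⇒≯ M≤su)
      {v = v} _ (inj₂ M≤sv) → contradiction (proj₂ (bounded s) v) (≤⇒≯ M≤sv)
    colorDownTo (suc t) t′ eq
      with c , proper ← colorDownTo t (suc t′) (trans (+-suc t t′) eq)
      with any? (λ v → ¬? (P? v) ×-dec s v ≟ t′)
    ... | no none = c , λ Su Sv → proper (weaken Su) (weaken Sv)
      where
      weaken : ∀ {u} → P u ⊎ t′ ≤ s u → P u ⊎ suc t′ ≤ s u
      weaken (inj₁ Pu)     = inj₁ Pu
      weaken {u} (inj₂ t′≤su) with P? u
      ... | yes Pu = inj₁ Pu
      ... | no ¬Pu = inj₂ (≤∧≢⇒< t′≤su λ eq → none (u , ¬Pu , sym eq))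
    ... | yes (v , ¬Pv , refl) = proj₁ ext , λ Su Sv → proj₂ ext (split Su) (split Sv)
      where
      ext = extend (λ u → P? u ⊎-dec suc (s v) ≤? s u) proper v
        (≤-<-trans
          (sum-mono-≤ λ u → 𝟙-mono (R? v u ×-dec (P? u ⊎-dec suc (s v) ≤? s u)) (R? v u ×-dec (P? u ⊎-dec r v ≤? r u))
            λ where
              (Rvu , inj₁ Pu)    → Rvu , inj₁ Pu
              (Rvu , inj₂ sv<su) → Rvu , inj₂ (s-reflects-≤ (<⇒≤ sv<su)))
          (few v ¬Pv))
      split : ∀ {u} → P u ⊎ s v ≤ s u → u ≡ v ⊎ (P u ⊎ s v < s u)
      split (inj₁ Pu)        = inj₂ (inj₁ Pu)
      split {u} (inj₂ sv≤su) with u ≟ᶠ v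
      ... | yes u≡v = inj₁ u≡v
      ... | no  u≢v = inj₂ (inj₂ (≤∧≢⇒< sv≤su λ eq → u≢v (sym (s-injective eq))))

    greedy : ∃ λ c → ∀ {u v} → R u v → c u ≢ c v
    greedy = let c , proper = colorDownTo M 0 (+-identityʳ M) in
             c , proper (inj₂ z≤n) (inj₂ z≤n)

-- Counting incidences

module Incidences (H : Hypergraph) (linear : Linear H) where
  open Hypergraph H using (#V; edge; distinct; covers; degree; #ofDegree)

  N = #E H

  I J : Fin #V → Fin N → ℕ
  I v e = 𝟙 (v ∈? edge e)
  J v e = 𝟙 (¬? (v ∈? edge e))

  d : Fin #V → ℕ
  d v = sum (I v)

  d≡degree : ∀ v → degree v ≡ d v
  d≡degree v = count≡# (λ e → v ∈? edge e) id

  #ofDegree≡# : ∀ k → #ofDegree k ≡ # (λ v → d v ≟ k)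
  #ofDegree≡# k = trans (count≡# (λ v → degree v ≟ k) id)
    (sum-cong-≗ λ v → cong (λ x → 𝟙 (x ≟ k)) (d≡degree v))

  -- `A` counts common edges, `X` the edges through `u` that avoid `v`. For adjacent vertices these
  -- numbers are 1 and `d u` minus 1.
  A X : Fin #V → Fin #V → ℕ
  A v u = sum λ e → I v e * I u e
  X v u = sum λ f → J v f * I u f

  Adj : Fin #V → Fin #V → Set
  Adj v u = v ≢ u × ∃ λ e → v ∈ edge e × u ∈ edge e

  Adj? : B.Decidable Adj
  Adj? v u = ¬? (v ≟ᶠ u) ×-dec any? λ e → (v ∈? edge e) ×-dec (u ∈? edge e)

  Adj-sym : ∀ {v u} → Adj v u → Adj u v
  Adj-sym (v≢u , e , v∈e , u∈e) = v≢u ∘ sym , e , u∈e , v∈e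

  Adj-irrefl : ∀ {v} → ¬ Adj v v
  Adj-irrefl (v≢v , _) = v≢v refl

  meet-once : ∀ {e f x y} → e ≢ f → x ∈ edge e → x ∈ edge f → y ∈ edge e → y ∈ edge f → x ≡ y
  meet-once {e} {f} {x} {y} e≢f x∈e x∈f y∈e y∈f with x ≟ᶠ y
  ... | yes x≡y = x≡y
  ... | no  x≢y = contradiction (linear e f (e≢f ∘ distinct)) (<⇒≱ (begin
    2                                                       ≡⟨ cong₂ _+_ (in∩ x∈e x∈f) (in∩ y∈e y∈f) ⟨
    𝟙 (x ∈? (edge e ∩ edge f)) + 𝟙 (y ∈? (edge e ∩ edge f))  ≤⟨ two-terms≤sum _ x≢y ⟩
    # (_∈? (edge e ∩ edge f))                               ≡⟨ ∣ edge e ∩ edge f ∣≡# ⟨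
    ∣ edge e ∩ edge f ∣                                     ∎))
    where
    open ≤-Reasoning
    in∩ : ∀ {z} → z ∈ edge e → z ∈ edge f → 𝟙 (z ∈? (edge e ∩ edge f)) ≡ 1
    in∩ z∈e z∈f = 𝟙-yes (_ ∈? _) (x∈p∩q⁺ (z∈e , z∈f))

  I*I-positive : ∀ {v u e f} → 0 < I v e * I u f → v ∈ edge e × u ∈ edge f
  I*I-positive p = let p₁ , p₂ = 0<* p in 𝟙-positive (_ ∈? _) p₁ , 𝟙-positive (_ ∈? _) p₂

  I≡1 : ∀ {v e} → v ∈ edge e → I v e ≡ 1
  I≡1 = 𝟙-yes (_ ∈? _)

  I≤1 : ∀ v e → I v e ≤ 1
  I≤1 v e = 𝟙≤1 (v ∈? edge e)

  A≤1 : ∀ {v u} → v ≢ u → A v u ≤ 1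
  A≤1 {v} {u} v≢u = sum≤1 _ (λ e → *-mono-≤ (I≤1 v e) (I≤1 u e)) unique
    where
    unique : ∀ e f → 0 < I v e * I u e → 0 < I v f * I u f → e ≡ f
    unique e f p q with e ≟ᶠ f
    ... | yes e≡f = e≡f
    ... | no  e≢f =
      let v∈e , u∈e = I*I-positive {v} {u} {e} {e} p
          v∈f , u∈f = I*I-positive {v} {u} {f} {f} q
      in contradiction (meet-once e≢f v∈e v∈f u∈e u∈f) v≢u

  A-positive : ∀ {v u e} → v ∈ edge e → u ∈ edge e → 1 ≤ A v u
  A-positive {v} {u} {e} v∈e u∈e =
    ≤-trans (≤-reflexive (sym (cong₂ _*_ (I≡1 v∈e) (I≡1 u∈e)))) (term≤sum _ e)

  Adj⇒A≡1 : ∀ {v u} → Adj v u → A v u ≡ 1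
  Adj⇒A≡1 (v≢u , e , v∈e , u∈e) = ≤-antisym (A≤1 v≢u) (A-positive v∈e u∈e)

  A-Adj : ∀ {v u} → v ≢ u → A v u ≡ 𝟙 (Adj? v u)
  A-Adj {v} {u} v≢u = ≤-antisym
    (≮⇒≥ λ 𝟙<A → <⇒≱ 𝟙<A (≤-trans (A≤1 v≢u) (≤-reflexive (sym (𝟙-yes (Adj? v u) (adj (≤-<-trans z≤n 𝟙<A)))))))
    (𝟙-≤ (Adj? v u) λ a → ≤-reflexive (sym (Adj⇒A≡1 a)))
    where
    adj : 0 < A v u → Adj v u
    adj 0<A = let e , p = sum-positive (λ e → I v e * I u e) 0<A
              in v≢u , e , I*I-positive {v} {u} {e} {e} p

  d≡A+X : ∀ v u → d u ≡ A v u + X v u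
  d≡A+X v u = trans
    (sum-cong-≗ λ e → begin
      I u e                            ≡⟨ +-identityʳ _ ⟨
      1 * I u e                        ≡⟨ cong (_* I u e) (𝟙-+-¬ (v ∈? edge e)) ⟨
      (I v e + J v e) * I u e          ≡⟨ *-distribʳ-+ (I u e) (I v e) (J v e) ⟩
      I v e * I u e + J v e * I u e    ∎)
    (∑-distrib-+ (λ e → I v e * I u e) (λ e → J v e * I u e))
    where open ≡-Reasoning

  Adj⇒d≡1+X : ∀ {v u} → Adj v u → d u ≡ suc (X v u)
  Adj⇒d≡1+X {v} {u} a = trans (d≡A+X v u) (cong (_+ X v u) (Adj⇒A≡1 a))

  codegree : Fin #V → ℕ
  codegree v = sum (J v)

  d+codegree : ∀ v → d v + codegree v ≡ N
  d+codegree v = begin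
    sum (I v) + sum (J v)        ≡⟨ ∑-distrib-+ (I v) (J v) ⟨
    sum (λ e → I v e + J v e)    ≡⟨ sum-cong-≗ (λ e → 𝟙-+-¬ (v ∈? edge e)) ⟩
    sum {N} (λ _ → 1)            ≡⟨ sum-ones N ⟩
    N                            ∎
    where open ≡-Reasoning

  d-positive : ∀ v → 0 < d v
  d-positive v = let e , v∈e = covers v in
    ≤-trans (≤-reflexive (sym (I≡1 v∈e))) (term≤sum (I v) e)

  -- `q` is the indicator of a set of vertices, later all of them or those of one degree. `S e f`
  -- counts the selected vertices common to `e` and `f`; `T v` counts triples of a selected `u`, an
  -- edge through `u` and `v`, and an edge through `u` avoiding `v`.
  module Weighted (q : Fin #V → ℕ) (q≤1 : ∀ u → q u ≤ 1) where

    S : Fin N → Fin N → ℕ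
    S e f = sum λ u → q u * (I u e * I u f)

    S-positive : ∀ {e f} → 0 < S e f → ∃ λ u → 0 < q u × u ∈ edge e × u ∈ edge f
    S-positive {e} {f} p =
      let u , pᵤ  = sum-positive (λ u → q u * (I u e * I u f)) p
          p₁ , p₂ = 0<* {q u} pᵤ
      in u , p₁ , I*I-positive {u} {u} {e} {f} p₂

    S≤1 : ∀ {e f} → e ≢ f → S e f ≤ 1
    S≤1 {e} {f} e≢f = sum≤1 _ (λ u → *-mono-≤ (q≤1 u) (*-mono-≤ (I≤1 u e) (I≤1 u f))) λ u w p p′ →
      let u∈e , u∈f = I*I-positive {u} {u} {e} {f} (proj₂ (0<* {q u} p))
          w∈e , w∈f = I*I-positive {w} {w} {e} {f} (proj₂ (0<* {q w} p′))
      in meet-once e≢f u∈e u∈f w∈e w∈f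

    1≤S : ∀ {e f u} → q u ≡ 1 → u ∈ edge e → u ∈ edge f → 1 ≤ S e f
    1≤S {u = u} qu≡1 u∈e u∈f =
      ≤-trans (≤-reflexive (sym (cong₂ _*_ qu≡1 (cong₂ _*_ (I≡1 u∈e) (I≡1 u∈f))))) (term≤sum _ u)

    T : Fin #V → ℕ
    T v = sum λ u → q u * (A v u * X v u)

    T-as-edge-pairs : ∀ v → T v ≡ sum λ e → sum λ f → (I v e * J v f) * S e f
    T-as-edge-pairs v = begin
      T v
        ≡⟨ sum-cong-≗ (λ u → cong (q u *_) (sum-*-sum (λ e → I v e * I u e) (λ f → J v f * I u f))) ⟩
      sum (λ u → q u * sum λ e → sum λ f → (I v e * I u e) * (J v f * I u f))
        ≡⟨ sum-cong-≗ (λ u → trans (*-distribˡ-sum (q u) (λ e → sum λ f → (I v e * I u e) * (J v f * I u f)))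
             (sum-cong-≗ λ e → *-distribˡ-sum (q u) (λ f → (I v e * I u e) * (J v f * I u f)))) ⟩
      sum (λ u → sum λ e → sum λ f → q u * ((I v e * I u e) * (J v f * I u f)))
        ≡⟨ sum-cong-≗ (λ u → sum-cong-≗ λ e → sum-cong-≗ λ f → rearrange (q u) (I v e) (I u e) (J v f) (I u f)) ⟩
      sum (λ u → sum λ e → sum λ f → t u e f)
        ≡⟨ ∑-comm (λ u e → sum λ f → t u e f) ⟩
      sum (λ e → sum λ u → sum λ f → t u e f)
        ≡⟨ sum-cong-≗ (λ e → ∑-comm (λ u f → t u e f)) ⟩
      sum (λ e → sum λ f → sum λ u → t u e f)
        ≡⟨ sum-cong-≗ (λ e → sum-cong-≗ λ f → *-distribˡ-sum (I v e * J v f) (λ u → q u * (I u e * I u f))) ⟨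
      sum (λ e → sum λ f → (I v e * J v f) * S e f)
        ∎
      where
      open ≡-Reasoning
      t : Fin #V → Fin N → Fin N → ℕ
      t u e f = (I v e * J v f) * (q u * (I u e * I u f))
      rearrange : ∀ q a b c d → q * ((a * b) * (c * d)) ≡ (a * c) * (q * (b * d))
      rearrange = solve-∀

    incident-≢ : ∀ {v e f} → v ∈ edge e → ¬ v ∈ edge f → e ≢ f
    incident-≢ v∈e v∉f refl = v∉f v∈e

    pair≤ : ∀ v e f → (I v e * J v f) * S e f ≤ I v e * J v f
    pair≤ v e f with v ∈? edge e | v ∈? edge f
    ... | no  _   | _       = z≤n
    ... | yes _   | yes _   = z≤n
    ... | yes v∈e | no  v∉f = *-mono-≤ {1} ≤-refl (S≤1 (incident-≢ v∈e v∉f))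

    -- An edge through `v` and an edge avoiding `v` are distinct, so by linearity they share at most
    -- one vertex.
    T≤ : ∀ v → T v ≤ d v * codegree v
    T≤ v = begin
      T v                                            ≡⟨ T-as-edge-pairs v ⟩
      sum (λ e → sum λ f → (I v e * J v f) * S e f)  ≤⟨ sum-mono-≤ (λ e → sum-mono-≤ (pair≤ v e)) ⟩
      sum (λ e → sum λ f → I v e * J v f)            ≡⟨ sum-*-sum (I v) (J v) ⟨
      d v * codegree v                               ∎
      where open ≤-Reasoning

    -- Equality leaves no slack in any pair of edges; the squeeze is applied to the sum over `e` and
    -- then to the sum over `f`.
    T-tight : ∀ v → d v * codegree v ≤ T v → ∀ {e f} → v ∈ edge e → ¬ v ∈ edge f →
              ∃ λ u → 0 < q u × u ∈ edge e × u ∈ edge f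
    T-tight v tight {e} {f} v∈e v∉f = S-positive (proj₂ (0<* {I v e * J v f} (begin
      1                          ≡⟨ cong₂ _*_ (I≡1 v∈e) (𝟙-yes (¬? (v ∈? edge f)) v∉f) ⟨
      I v e * J v f              ≤⟨ sum-squeeze (pair≤ v e) (sum-squeeze (λ e → sum-mono-≤ (pair≤ v e)) total e) f ⟩
      (I v e * J v f) * S e f    ∎)))
      where
      open ≤-Reasoning
      total : sum (λ e → sum λ f → I v e * J v f) ≤ sum (λ e → sum λ f → (I v e * J v f) * S e f)
      total = ≤-trans (≤-reflexive (sym (sum-*-sum (I v) (J v)))) (≤-trans tight (≤-reflexive (T-as-edge-pairs v)))

-- Vertices at which the greedy bound fails

module BadVertices (H : Hypergraph) (linear : Linear H) (uniform : Uniform H (#E H)) (dense : WeaklyDense H) where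
  open Hypergraph H using (#V; edge; distinct; covers; degree; #ofDegree)
  open Incidences H linear

  edge-size : ∀ e → sum (λ u → I u e) ≡ N
  edge-size e = trans (sym ∣ edge e ∣≡#) (uniform e)

  sum-A : ∀ v → sum (A v) ≡ d v * N
  sum-A v = begin
    sum (λ u → sum λ e → I v e * I u e)   ≡⟨ ∑-comm (λ u e → I v e * I u e) ⟩
    sum (λ e → sum λ u → I v e * I u e)   ≡⟨ sum-cong-≗ (λ e → *-distribˡ-sum (I v e) (λ u → I u e)) ⟨
    sum (λ e → I v e * sum λ u → I u e)   ≡⟨ sum-cong-≗ (λ e → cong (I v e *_) (edge-size e)) ⟩
    sum (λ e → I v e * N)                 ≡⟨ *-distribʳ-sum N (I v) ⟨
    d v * N                               ∎
    where open ≡-Reasoning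

  upper? : ∀ v u → Dec (Adj v u × d v ≤ d u)
  upper? v u = Adj? v u ×-dec d v ≤? d u

  level? : ∀ v u → Dec (Adj v u × d u ≡ d v)
  level? v u = Adj? v u ×-dec d u ≟ d v

  #upper #level : Fin #V → ℕ
  #upper v = # (upper? v)
  #level v = # (level? v)

  -- The diagonal term makes this strict: `v` shares an edge with itself but is not its own
  -- neighbor.
  #upper<d*N : ∀ v → #upper v < d v * N
  #upper<d*N v = begin-strict
    #upper v   <⟨ sum-mono-< (λ u → 𝟙-≤ (upper? v u) λ (a , _) → ≤-reflexive (sym (Adj⇒A≡1 a))) v
                    (≤-trans (≤-reflexive (cong suc (𝟙-no (upper? v v) (Adj-irrefl ∘ proj₁))))
                             (let e , v∈e = covers v in A-positive v∈e v∈e)) ⟩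
    sum (A v)  ≡⟨ sum-A v ⟩
    d v * N    ∎
    where open ≤-Reasoning

  module All = Weighted (λ _ → 1) (λ _ → ≤-refl)
  module OfDegree k = Weighted (λ u → 𝟙 (d u ≟ k)) (λ u → 𝟙≤1 (d u ≟ k))

  -- An upper neighbor `u` shares exactly one edge with `v`, so at least `d v` minus 1 of its edges
  -- avoid `v`.
  #upper*pred≤T : ∀ v → #upper v * pred (d v) ≤ All.T v
  #upper*pred≤T v = ≤-trans (≤-reflexive (*-distribʳ-sum (pred (d v)) (𝟙 ∘ upper? v)))
    (sum-mono-≤ λ u → 𝟙-*-≤ (upper? v u) λ (a , dv≤du) → begin
      pred (d v)           ≤⟨ pred-mono-≤ dv≤du ⟩
      pred (d u)           ≡⟨ cong pred (Adj⇒d≡1+X a) ⟩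
      X v u                ≡⟨ *-identityˡ _ ⟨
      1 * X v u            ≡⟨ cong (_* X v u) (Adj⇒A≡1 a) ⟨
      A v u * X v u        ≡⟨ *-identityˡ _ ⟨
      1 * (A v u * X v u)  ∎)
    where open ≤-Reasoning

  -- Upper neighbors of larger degree contribute at least `d v` to `T`; those of equal degree fall
  -- short by one, which `#level v` makes up.
  #upper*d≤T+#level : ∀ v → #upper v * d v ≤ All.T v + #level v
  #upper*d≤T+#level v = begin
    #upper v * d v                                      ≡⟨ *-distribʳ-sum (d v) (𝟙 ∘ upper? v) ⟩
    sum (λ u → 𝟙 (upper? v u) * d v)                    ≤⟨ sum-mono-≤ (λ u → 𝟙-*-≤ (upper? v u) (bound u)) ⟩
    sum (λ u → 1 * (A v u * X v u) + 𝟙 (level? v u))    ≡⟨ ∑-distrib-+ (λ u → 1 * (A v u * X v u)) (𝟙 ∘ level? v) ⟩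
    All.T v + #level v                                  ∎
    where
    open ≤-Reasoning
    bound : ∀ u → Adj v u × d v ≤ d u → d v ≤ 1 * (A v u * X v u) + 𝟙 (level? v u)
    bound u (a , dv≤du) with d u ≟ d v
    ... | yes du≡dv = begin
      d v                                        ≡⟨ du≡dv ⟨
      d u                                        ≡⟨ Adj⇒d≡1+X a ⟩
      suc (X v u)                                ≡⟨ simplify (X v u) ⟩
      1 * (1 * X v u) + 1                        ≡⟨ cong₂ (λ x y → 1 * (x * X v u) + y) (Adj⇒A≡1 a) (𝟙-yes (level? v u) (a , du≡dv)) ⟨
      1 * (A v u * X v u) + 𝟙 (level? v u) ∎
      where
      simplify : ∀ x → suc x ≡ 1 * (1 * x) + 1
      simplify = solve-∀
    ... | no du≢dv = begin
      d v                                        ≤⟨ ≤-pred (≤-trans (≤∧≢⇒< dv≤du (du≢dv ∘ sym)) (≤-reflexive (Adj⇒d≡1+X a))) ⟩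
      X v u                                      ≡⟨ simplify (X v u) ⟩
      1 * (1 * X v u)                            ≡⟨ cong (λ x → 1 * (x * X v u)) (Adj⇒A≡1 a) ⟨
      1 * (A v u * X v u)                        ≤⟨ m≤m+n _ _ ⟩
      1 * (A v u * X v u) + _                    ∎
      where
      simplify : ∀ x → x ≡ 1 * (1 * x)
      simplify = solve-∀

  #level*pred≤T : ∀ v → #level v * pred (d v) ≤ OfDegree.T (d v) v
  #level*pred≤T v = ≤-trans (≤-reflexive (*-distribʳ-sum (pred (d v)) (𝟙 ∘ level? v)))
    (sum-mono-≤ λ u → 𝟙-*-≤ (level? v u) λ (a , du≡dv) → begin
      pred (d v)                           ≡⟨ cong pred du≡dv ⟨
      pred (d u)                           ≡⟨ cong pred (Adj⇒d≡1+X a) ⟩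
      X v u                                ≡⟨ *-identityˡ _ ⟨
      1 * X v u                            ≡⟨ cong (_* X v u) (Adj⇒A≡1 a) ⟨
      A v u * X v u                        ≡⟨ *-identityˡ _ ⟨
      1 * (A v u * X v u)                  ≡⟨ cong (_* (A v u * X v u)) (𝟙-yes (d u ≟ d v) du≡dv) ⟨
      𝟙 (d u ≟ d v) * (A v u * X v u)      ∎)
    where open ≤-Reasoning

  -- The extra vertex is `v` itself; it is what turns `k*k≤#level` into a violation of weak density.
  #level<#ofDegree : ∀ v → #level v < #ofDegree (d v)
  #level<#ofDegree v = ≤-trans
    (sum-mono-< (λ u → 𝟙-mono (level? v u) (d u ≟ d v) proj₂) v
      (𝟙-< (level? v v) (d v ≟ d v) (Adj-irrefl ∘ proj₁) refl))
    (≤-reflexive (sym (#ofDegree≡# (d v))))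

  Bad : Fin #V → Set
  Bad v = N ≤ #upper v

  Bad? : Decidable Bad
  Bad? v = N ≤? #upper v

  module _ {v} (bad : Bad v) where

    2≤d : 2 ≤ d v
    2≤d = ≤∧≢⇒< (d-positive v) λ 1≡d →
      <⇒≱ (#upper<d*N v) (≤-trans (≤-reflexive (trans (cong (_* N) (sym 1≡d)) (+-identityʳ N))) bad)

    private
      k = d v
      h = codegree v

      k≡1+pred : k ≡ suc (pred k)
      k≡1+pred = sym (suc-pred k {{>-nonZero (d-positive v)}})

    -- With `N` equal to `k + h`, badness gives `(k + h) * k ≤ k * h + #level v`, and `k * h`
    -- cancels.
    k*k≤#level : k * k ≤ #level v
    k*k≤#level = +-cancelˡ-≤ (k * h) _ _ (begin
      k * h + k * k      ≡⟨ rearrange k h ⟩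
      (k + h) * k        ≡⟨ cong (_* k) (d+codegree v) ⟩
      N * k              ≤⟨ *-monoˡ-≤ k bad ⟩
      #upper v * k       ≤⟨ #upper*d≤T+#level v ⟩
      All.T v + #level v ≤⟨ +-monoˡ-≤ (#level v) (All.T≤ v) ⟩
      k * h + #level v   ∎)
      where
      open ≤-Reasoning
      rearrange : ∀ k h → k * h + k * k ≡ (k + h) * k
      rearrange = solve-∀

    -- Here `(k + h) * pred k ≤ k * h`, and cancelling `h * pred k` leaves a single `h` on the
    -- right.
    k*pred≤h : k * pred k ≤ h
    k*pred≤h = +-cancelˡ-≤ (h * pred k) _ _ (begin
      h * pred k + k * pred k  ≡⟨ rearrange h k (pred k) ⟩
      (k + h) * pred k         ≡⟨ cong (_* pred k) (d+codegree v) ⟩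
      N * pred k               ≤⟨ *-monoˡ-≤ (pred k) bad ⟩
      #upper v * pred k        ≤⟨ #upper*pred≤T v ⟩
      All.T v                  ≤⟨ All.T≤ v ⟩
      k * h                    ≡⟨ cong (_* h) k≡1+pred ⟩
      h + pred k * h           ≡⟨ +-comm h (pred k * h) ⟩
      pred k * h + h           ≡⟨ cong (_+ h) (*-comm (pred k) h) ⟩
      h * pred k + h           ∎)
      where
      open ≤-Reasoning
      rearrange : ∀ h k p → h * p + k * p ≡ (k + h) * p
      rearrange = solve-∀

    k*k≡k+k*pred : k * k ≡ k + k * pred k
    k*k≡k+k*pred = trans (cong (k *_) k≡1+pred) (*-suc k (pred k))

    -- Adding `k` to `k*pred≤h` gives one bound. If `k * k` were below `N`, weak density would allow
    -- at most `k * k` vertices of degree `k`, but `v` and its neighbors of that degree are more.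
    bad⇒d*d≡N : k * k ≡ N
    bad⇒d*d≡N = ≤-antisym
      (≤-trans (≤-reflexive k*k≡k+k*pred) (≤-trans (+-monoʳ-≤ k k*pred≤h) (≤-reflexive (d+codegree v))))
      (≮⇒≥ λ k*k<N → <⇒≱ (#level<#ofDegree v)
        (≤-trans (dense k 2≤d (≤-trans (≤-reflexive (cong suc k^2)) k*k<N))
                 (≤-trans (≤-reflexive k^2) k*k≤#level)))
      where
      k^2 : k ^ 2 ≡ k * k
      k^2 = cong (k *_) (*-identityʳ k)

    h≡k*pred : h ≡ k * pred k
    h≡k*pred = +-cancelˡ-≡ k _ _ (trans (d+codegree v) (trans (sym bad⇒d*d≡N) k*k≡k+k*pred))

    k*h≡N*pred : k * h ≡ N * pred k
    k*h≡N*pred = trans (cong (k *_) h≡k*pred) (trans (sym (*-assoc k k (pred k))) (cong (_* pred k) bad⇒d*d≡N))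

    -- A bad vertex thus has exactly `N` upper neighbors, so a single uncolored one among them frees
    -- a color.
    #upper≤N : #upper v ≤ N
    #upper≤N = *-cancelʳ-≤ _ _ (pred k) {{>-nonZero (pred-mono-≤ 2≤d)}}
      (≤-trans (#upper*pred≤T v) (≤-trans (All.T≤ v) (≤-reflexive k*h≡N*pred)))

    -- Already the triples with `u` of degree `k` attain the maximum `k * h`, so every such pair of
    -- edges shares a vertex of that degree.
    edges-meet : ∀ {e f} → v ∈ edge e → ¬ v ∈ edge f → ∃ λ u → d u ≡ k × u ∈ edge e × u ∈ edge f
    edges-meet v∈e v∉f =
      let u , p , u∈e , u∈f = OfDegree.T-tight k v tight v∈e v∉f in u , 𝟙-positive (d u ≟ k) p , u∈e , u∈f
      where
      open ≤-Reasoning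
      tight : k * h ≤ OfDegree.T k v
      tight = begin
        k * h               ≡⟨ k*h≡N*pred ⟩
        N * pred k          ≡⟨ cong (_* pred k) bad⇒d*d≡N ⟨
        (k * k) * pred k    ≤⟨ *-monoˡ-≤ (pred k) k*k≤#level ⟩
        #level v * pred k   ≤⟨ #level*pred≤T v ⟩
        OfDegree.T k v      ∎

-- Coloring with `N` colors

square-injective : ∀ {a b} → a * a ≡ b * b → a ≡ b
square-injective a²≡b² = ≤-antisym
  (≮⇒≥ λ b<a → <⇒≢ (*-mono-< b<a b<a) (sym a²≡b²))
  (≮⇒≥ λ a<b → <⇒≢ (*-mono-< a<b a<b) a²≡b²)

module Colorings (H : Hypergraph) (linear : Linear H) (uniform : Uniform H (#E H)) (dense : WeaklyDense H)
                 (e₀ : Fin (#E H)) where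
  open Hypergraph H using (#V; edge; covers)
  open Incidences H linear
  open BadVertices H linear uniform dense

  Colored : Set
  Colored = ∃ λ (c : Fin #V → Fin N) → ∀ {u v} → Adj u v → c u ≢ c v

  bad⇒same-degree : ∀ {u} v → Bad u → d v * d v ≡ N → d u ≡ d v
  bad⇒same-degree v badᵤ d*d≡N = square-injective (trans (bad⇒d*d≡N badᵤ) (sym d*d≡N))

  -- Nothing is precolored. By `refines` all neighbors colored earlier are upper ones; at a bad
  -- vertex the last hypothesis excludes one of its at most `N` upper neighbors.
  colorByRank : (r : Fin #V → ℕ) → (∀ {u v} → r v ≤ r u → d v ≤ d u) →
                (∀ {v} → Bad v → ∃ λ u → Adj v u × d v ≤ d u × r u < r v) → Colored
  colorByRank r refines bad⇒lower = greedy (λ _ → no λ ()) (λ _ → e₀) (λ ()) r few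
    where
    open Greedy Adj? Adj-sym Adj-irrefl
    earlier? : ∀ v u → Dec (Adj v u × (⊥ ⊎ r v ≤ r u))
    earlier? v u = Adj? v u ×-dec (no (λ ()) ⊎-dec r v ≤? r u)
    earlier⇒upper : ∀ {v u} → Adj v u × (⊥ ⊎ r v ≤ r u) → Adj v u × d v ≤ d u
    earlier⇒upper (a , inj₂ rv≤ru) = a , refines rv≤ru
    few : ∀ v → ¬ ⊥ → # (earlier? v) < N
    few v _ with Bad? v
    ... | no ¬bad = ≤-<-trans (sum-mono-≤ λ u → 𝟙-mono (earlier? v u) (upper? v u) earlier⇒upper) (≰⇒> ¬bad)
    ... | yes bad = let u , a , dv≤du , ru<rv = bad⇒lower bad in <-≤-trans
      (sum-mono-< (λ u → 𝟙-mono (earlier? v u) (upper? v u) earlier⇒upper) u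
        (𝟙-< (earlier? v u) (upper? v u) (λ where (_ , inj₂ rv≤ru) → <⇒≱ ru<rv rv≤ru) (a , dv≤du)))
      (#upper≤N bad)

  -- Every bad vertex is within distance two of w, so ranking the vertices of
  -- the same degree by their distance to w leaves each bad vertex an
  -- uncolored neighbor when its turn comes.
  module AroundGoodVertex (w : Fin #V) (d*d≡N : d w * d w ≡ N) (good : ¬ Bad w) where

    Near : Fin #V → Set
    Near v = ∃ λ e → w ∈ edge e × v ∈ edge e

    Near? : Decidable Near
    Near? v = any? λ e → (w ∈? edge e) ×-dec (v ∈? edge e)

    -- The distance to `w` is cut off at 2. The factor 3 in `r` exceeds it, so the degree takes
    -- precedence.
    distance r : Fin #V → ℕ
    distance v = 𝟙 (¬? (v ≟ᶠ w)) + 𝟙 (¬? (Near? v))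
    r v = d v * 3 + distance v

    distance≤2 : ∀ v → distance v ≤ 2
    distance≤2 v = +-mono-≤ (𝟙≤1 (¬? (v ≟ᶠ w))) (𝟙≤1 (¬? (Near? v)))

    refines : ∀ {u v} → r v ≤ r u → d v ≤ d u
    refines {u} {v} rv≤ru = ≮⇒≥ λ du<dv → <⇒≱ (begin-strict
      d u * 3 + distance u  <⟨ +-monoʳ-< (d u * 3) (s≤s (distance≤2 u)) ⟩
      d u * 3 + 3           ≡⟨ +-comm (d u * 3) 3 ⟩
      suc (d u) * 3         ≤⟨ *-monoˡ-≤ 3 du<dv ⟩
      d v * 3               ≤⟨ m≤m+n _ _ ⟩
      r v                   ∎) rv≤ru
      where open ≤-Reasoning

    closer : ∀ {u v} → d u ≡ d v → distance u < distance v → r u < r v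
    closer {u} {v} du≡dv lt = subst (λ x → r u < x * 3 + distance v) du≡dv (+-monoʳ-< (d u * 3) lt)

    bad⇒closer : ∀ {v} → Bad v → ∃ λ u → Adj v u × d v ≤ d u × r u < r v
    bad⇒closer {v} bad = by-distance (Near? v)
      where
      open ≤-Reasoning
      v≢w : v ≢ w
      v≢w refl = good bad
      dw≡dv : d w ≡ d v
      dw≡dv = sym (bad⇒same-degree w bad d*d≡N)
      by-distance : Dec (Near v) → ∃ λ u → Adj v u × d v ≤ d u × r u < r v
      by-distance (yes (e , w∈e , v∈e)) =
        w , (v≢w , e , v∈e , w∈e) , ≤-reflexive (sym dw≡dv) , closer dw≡dv (begin-strict
          distance w   ≡⟨ cong₂ _+_ (𝟙-no (¬? (w ≟ᶠ w)) λ w≢w → w≢w refl) (𝟙-no (¬? (Near? w)) λ far → far (e , w∈e , w∈e)) ⟩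
          0            <⟨ s≤s z≤n ⟩
          1            ≡⟨ 𝟙-yes (¬? (v ≟ᶠ w)) v≢w ⟨
          𝟙 (¬? (v ≟ᶠ w)) ≤⟨ m≤m+n _ _ ⟩
          distance v   ∎)
      -- An edge `f` through `w` misses `v`, so it meets an edge `e` through `v` in a vertex of the
      -- same degree, which is adjacent to `v` and shares `f` with `w`.
      by-distance (no far) =
        let f , w∈f = covers w
            e , v∈e = covers v
            v∉f = λ v∈f → far (f , w∈f , v∈f)
            u , du≡dv , u∈e , u∈f = edges-meet bad v∈e v∉f
        in u , ((λ v≡u → v∉f (subst (_∈ edge f) (sym v≡u) u∈f)) , e , v∈e , u∈e) , ≤-reflexive (sym du≡dv) , closer du≡dv (begin-strict
          distance u   ≤⟨ +-mono-≤ (𝟙≤1 (¬? (u ≟ᶠ w))) (≤-reflexive (𝟙-no (¬? (Near? u)) λ ¬near → ¬near (f , w∈f , u∈f))) ⟩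
          1            <⟨ ≤-refl ⟩
          2            ≡⟨ cong₂ _+_ (𝟙-yes (¬? (v ≟ᶠ w)) v≢w) (𝟙-yes (¬? (Near? v)) far) ⟨
          distance v   ∎)

    colored : Colored
    colored = colorByRank r refines bad⇒closer

  -- Dually, the edges are the points and the vertices of degree k the lines
  -- of an affine plane of order k, whose parallel classes serve as colors.
  module AffinePlane (v₀ : Fin #V) (bad₀ : Bad v₀) (all-bad : ∀ v → d v ≡ d v₀ → Bad v) where

    k = d v₀

    open OfDegree k

    k*k≡N : k * k ≡ N
    k*k≡N = bad⇒d*d≡N bad₀

    K : Fin #V → ℕ
    K u = 𝟙 (d u ≟ k)

    line-through : ∀ e → ∃ λ u → d u ≡ k × u ∈ edge e
    line-through e with v₀ ∈? edge e
    ... | yes v₀∈e = v₀ , refl , v₀∈e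
    ... | no  v₀∉e = let _ , v₀∈f = covers v₀
                         u , du≡k , _ , u∈e = edges-meet bad₀ v₀∈f v₀∉e
                     in u , du≡k , u∈e

    -- A line through the point `e` is bad by `all-bad`; if it misses `f`, `edges-meet` supplies a
    -- line through both points.
    join : ∀ e f → ∃ λ u → d u ≡ k × u ∈ edge e × u ∈ edge f
    join e f with line-through e
    ... | v , dv≡k , v∈e with v ∈? edge f
    ...   | yes v∈f = v , dv≡k , v∈e , v∈f
    ...   | no  v∉f = let u , du≡dv , u∈e , u∈f = edges-meet (all-bad v dv≡k) v∈e v∉f
                      in u , trans du≡dv dv≡k , u∈e , u∈f

    S≡1 : ∀ {e f} → e ≢ f → S e f ≡ 1
    S≡1 {e} {f} e≢f = ≤-antisym (S≤1 e≢f)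
      (let u , du≡k , u∈e , u∈f = join e f in 1≤S (𝟙-yes (d u ≟ k) du≡k) u∈e u∈f)

    #lines : Fin N → ℕ
    #lines e = sum λ u → K u * I u e

    S-diagonal : ∀ e → S e e ≡ #lines e
    S-diagonal e = sum-cong-≗ λ u → cong (K u *_) (idem (u ∈? edge e))
      where
      idem : ∀ {P : Set} (P? : Dec P) → 𝟙 P? * 𝟙 P? ≡ 𝟙 P?
      idem (yes _) = refl
      idem (no  _) = refl

    -- Both sides count the pairs of a line through `e` and a point on it; each line has `k` points.
    #lines*k≡ΣS : ∀ e → #lines e * k ≡ sum (S e)
    #lines*k≡ΣS e = begin
      #lines e * k                                             ≡⟨ *-distribʳ-sum k (λ u → K u * I u e) ⟩
      sum (λ u → K u * I u e * k)                              ≡⟨ sum-cong-≗ (λ u → degree-k (d u ≟ k) (I u e)) ⟩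
      sum (λ u → K u * I u e * d u)                            ≡⟨ sum-cong-≗ (λ u → *-distribˡ-sum (K u * I u e) (I u)) ⟩
      sum (λ u → sum λ f → K u * I u e * I u f)                ≡⟨ ∑-comm (λ u f → K u * I u e * I u f) ⟩
      sum (λ f → sum λ u → K u * I u e * I u f)                ≡⟨ sum-cong-≗ (λ f → sum-cong-≗ λ u → *-assoc (K u) (I u e) (I u f)) ⟩
      sum (S e)                                                ∎
      where
      open ≡-Reasoning
      degree-k : ∀ {x y} (eq? : Dec (x ≡ y)) a → 𝟙 eq? * a * y ≡ 𝟙 eq? * a * x
      degree-k (yes refl) a = refl
      degree-k (no  _)    a = refl

    -- Every other point is joined to `e` by exactly one line, while the diagonal term is
    -- `#lines e`. The added 1 avoids subtraction.
    ΣS+1 : ∀ e → sum (S e) + 1 ≡ N + #lines e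
    ΣS+1 e = begin
      sum (S e) + 1                              ≡⟨ cong (sum (S e) +_) (#-single e) ⟨
      sum (S e) + # (_≟ᶠ e)                      ≡⟨ ∑-distrib-+ (S e) (λ f → 𝟙 (f ≟ᶠ e)) ⟨
      sum (λ f → S e f + 𝟙 (f ≟ᶠ e))             ≡⟨ sum-cong-≗ (λ f → pointwise f (f ≟ᶠ e)) ⟩
      sum (λ f → 1 + 𝟙 (f ≟ᶠ e) * #lines e)      ≡⟨ ∑-distrib-+ (λ _ → 1) (λ f → 𝟙 (f ≟ᶠ e) * #lines e) ⟩
      sum {N} (λ _ → 1) + sum (λ f → 𝟙 (f ≟ᶠ e) * #lines e)
        ≡⟨ cong₂ _+_ (sum-ones N) (sym (*-distribʳ-sum (#lines e) (λ f → 𝟙 (f ≟ᶠ e)))) ⟩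
      N + # (_≟ᶠ e) * #lines e                   ≡⟨ cong (λ x → N + x * #lines e) (#-single e) ⟩
      N + 1 * #lines e                           ≡⟨ cong (N +_) (*-identityˡ _) ⟩
      N + #lines e                               ∎
      where
      open ≡-Reasoning
      pointwise : ∀ f (eq? : Dec (f ≡ e)) → S e f + 𝟙 eq? ≡ 1 + 𝟙 eq? * #lines e
      pointwise f (yes refl) = trans (+-comm (S f f) 1) (cong suc (trans (S-diagonal f) (sym (*-identityˡ _))))
      pointwise f (no f≢e)   = trans (+-identityʳ _) (S≡1 (f≢e ∘ sym))

    #lines≡k+1 : ∀ e → #lines e ≡ suc k
    #lines≡k+1 e = arithmetic k (#lines e) (2≤d bad₀) (begin
      #lines e * k + 1   ≡⟨ cong (_+ 1) (#lines*k≡ΣS e) ⟩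
      sum (S e) + 1      ≡⟨ ΣS+1 e ⟩
      N + #lines e       ≡⟨ cong (_+ #lines e) k*k≡N ⟨
      k * k + #lines e   ∎)
      where
      open ≡-Reasoning
      expandˡ : ∀ D p → D * (1 + (1 + p)) + 1 ≡ D * (1 + p) + (1 + D)
      expandˡ = solve-∀
      expandʳ : ∀ D p → (1 + (1 + p)) * (1 + (1 + p)) + D ≡ (1 + (1 + (1 + p))) * (1 + p) + (1 + D)
      expandʳ = solve-∀
      -- The equation says that `D` and `k + 1` agree after multiplication by `k` minus 1, which is
      -- positive; `p` is `k` minus 2.
      arithmetic : ∀ k D → 2 ≤ k → D * k + 1 ≡ k * k + D → D ≡ suc k
      arithmetic (suc (suc p)) D (s≤s (s≤s _)) eq = *-cancelʳ-≡ D _ (suc p)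
        (+-cancelʳ-≡ (1 + D) _ _ (trans (sym (expandˡ D p)) (trans eq (expandʳ D p))))

    module _ {v} (dv≡k : d v ≡ k) {e} (v∉e : ¬ v ∈ edge e) where

      -- The sum is regrouped by the points `f` of the line `v`: each of these `k` points is joined
      -- to `e` by exactly one line.
      #meeting : sum (λ w → K w * I w e * A v w) ≡ k
      #meeting = begin
        sum (λ w → K w * I w e * A v w)                            ≡⟨ sum-cong-≗ (λ w → *-distribˡ-sum (K w * I w e) (λ f → I v f * I w f)) ⟩
        sum (λ w → sum λ f → K w * I w e * (I v f * I w f))        ≡⟨ sum-cong-≗ (λ w → sum-cong-≗ λ f → rearrange (K w) (I w e) (I v f) (I w f)) ⟩
        sum (λ w → sum λ f → I v f * (K w * (I w f * I w e)))      ≡⟨ ∑-comm (λ w f → I v f * (K w * (I w f * I w e))) ⟩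
        sum (λ f → sum λ w → I v f * (K w * (I w f * I w e)))      ≡⟨ sum-cong-≗ (λ f → *-distribˡ-sum (I v f) (λ w → K w * (I w f * I w e))) ⟨
        sum (λ f → I v f * S f e)                                  ≡⟨ sum-cong-≗ (λ f → once f (v ∈? edge f)) ⟩
        d v                                                        ≡⟨ dv≡k ⟩
        k                                                          ∎
        where
        open ≡-Reasoning
        rearrange : ∀ a b c d → a * b * (c * d) ≡ c * (a * (d * b))
        rearrange = solve-∀
        once : ∀ f (∈f? : Dec (v ∈ edge f)) → 𝟙 ∈f? * S f e ≡ 𝟙 ∈f?
        once f (yes v∈f) = trans (*-identityˡ _) (S≡1 (incident-≢ v∈f v∉e))
        once f (no  _)   = refl

      -- Of the `k + 1` lines through `e`, exactly `k` meet `v`.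
      #parallel : sum (λ w → K w * I w e * 𝟙 (¬? (Adj? v w))) ≡ 1
      #parallel = +-cancelˡ-≡ k _ _ (begin
        k + sum (λ w → K w * I w e * 𝟙 (¬? (Adj? v w)))
          ≡⟨ cong (_+ sum (λ w → K w * I w e * 𝟙 (¬? (Adj? v w)))) #meeting ⟨
        sum (λ w → K w * I w e * A v w) + sum (λ w → K w * I w e * 𝟙 (¬? (Adj? v w)))
          ≡⟨ ∑-distrib-+ (λ w → K w * I w e * A v w) (λ w → K w * I w e * 𝟙 (¬? (Adj? v w))) ⟨
        sum (λ w → K w * I w e * A v w + K w * I w e * 𝟙 (¬? (Adj? v w)))
          ≡⟨ sum-cong-≗ (λ w → split w (w ∈? edge e)) ⟩
        #lines e
          ≡⟨ #lines≡k+1 e ⟩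
        suc k
          ≡⟨ +-comm k 1 ⟨
        k + 1 ∎)
        where
        open ≡-Reasoning
        split : ∀ w (∈e? : Dec (w ∈ edge e)) →
                K w * 𝟙 ∈e? * A v w + K w * 𝟙 ∈e? * 𝟙 (¬? (Adj? v w)) ≡ K w * 𝟙 ∈e?
        split w (no  _)   rewrite *-zeroʳ (K w) = refl
        split w (yes w∈e) = begin
          K w * 1 * A v w + K w * 1 * 𝟙 (¬? (Adj? v w))    ≡⟨ *-distribˡ-+ (K w * 1) (A v w) _ ⟨
          K w * 1 * (A v w + 𝟙 (¬? (Adj? v w)))            ≡⟨ cong (λ x → K w * 1 * (x + 𝟙 (¬? (Adj? v w)))) (A-Adj λ v≡w → v∉e (subst (_∈ edge e) (sym v≡w) w∈e)) ⟩
          K w * 1 * (𝟙 (Adj? v w) + 𝟙 (¬? (Adj? v w)))     ≡⟨ cong (K w * 1 *_) (𝟙-+-¬ (Adj? v w)) ⟩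
          K w * 1 * 1                                      ≡⟨ *-identityʳ _ ⟩
          K w * 1                                          ∎

    -- A line is also parallel to itself, because `Adj` is irreflexive.
    Parallel : Fin #V → Fin N → Fin #V → Set
    Parallel v e w = d w ≡ k × w ∈ edge e × ¬ Adj v w

    playfair-exists : ∀ {v} → d v ≡ k → ∀ e → ∃ (Parallel v e)
    playfair-exists {v} dv≡k e with v ∈? edge e
    ... | yes v∈e = v , dv≡k , v∈e , Adj-irrefl
    ... | no  v∉e =
      let w , p   = sum-positive _ (≤-reflexive (sym (#parallel dv≡k v∉e)))
          p₁₂ , p₃ = 0<* {K w * I w e} p
          p₁ , p₂ = 0<* {K w} p₁₂
      in w , 𝟙-positive (d w ≟ k) p₁ , 𝟙-positive (w ∈? edge e) p₂ , 𝟙-positive (¬? (Adj? v w)) p₃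

    -- If `e` lies on `v`, any other line through `e` meets `v` there, so both parallels are `v`;
    -- otherwise two of them would contradict `#parallel`.
    playfair-unique : ∀ {v} → d v ≡ k → ∀ {e x y} → Parallel v e x → Parallel v e y → x ≡ y
    playfair-unique {v} dv≡k {e} {x} {y} x∥v@(_ , x∈e , ¬vx) y∥v@(_ , y∈e , ¬vy) with v ∈? edge e | x ≟ᶠ y
    ... | _       | yes x≡y = x≡y
    ... | yes v∈e | _       = trans (sym (equal x∈e ¬vx)) (equal y∈e ¬vy)
      where
      equal : ∀ {w} → w ∈ edge e → ¬ Adj v w → v ≡ w
      equal {w} w∈e ¬vw = decidable-stable (v ≟ᶠ w) λ v≢w → ¬vw (v≢w , e , v∈e , w∈e)
    ... | no v∉e  | no x≢y  = contradiction (two-terms≤sum (λ w → K w * I w e * 𝟙 (¬? (Adj? v w))) x≢y)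
      (<⇒≱ (subst₂ _<_ (sym (#parallel dv≡k v∉e)) (sym (cong₂ _+_ (term x∥v) (term y∥v))) ≤-refl))
      where
      term : ∀ {w} → Parallel v e w → K w * I w e * 𝟙 (¬? (Adj? v w)) ≡ 1
      term {w} (dw≡k , w∈e , ¬vw) =
        cong₂ _*_ (cong₂ _*_ (𝟙-yes (d w ≟ k) dw≡k) (I≡1 w∈e)) (𝟙-yes (¬? (Adj? v w)) ¬vw)

    -- A vertex on two distinct edges is, by linearity, the line joining these points, of degree
    -- `k`; any other has degree at most 1.
    d≤k : ∀ v → d v ≤ k
    d≤k v = ≮⇒≥ λ k<dv → case any? (λ f → (v ∈? edge f) ×-dec ¬? (f ≟ᶠ proj₁ (covers v))) of λ where
      (yes (f , v∈f , f≢e)) →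
        let u , du≡k , u∈f , u∈e = join f _
            u≡v = meet-once f≢e u∈f u∈e v∈f (proj₂ (covers v))
        in <⇒≢ k<dv (trans (sym du≡k) (cong d u≡v))
      (no none) →
        let only = λ f p → decidable-stable (f ≟ᶠ proj₁ (covers v)) λ f≢e → none (f , 𝟙-positive (v ∈? edge f) p , f≢e)
        in <⇒≱ (<-trans (2≤d bad₀) k<dv)
             (sum≤1 (I v) (I≤1 v) λ e f p q → trans (only e p) (sym (only f q)))

    InE₀ : Fin #V → Fin #V → Set
    InE₀ u v = u ≢ v × u ∈ edge e₀ × v ∈ edge e₀

    InE₀? : B.Decidable InE₀
    InE₀? u v = ¬? (u ≟ᶠ v) ×-dec (u ∈? edge e₀) ×-dec (v ∈? edge e₀)

    -- Greedy coloring of the complete graph on the `N` vertices of `e₀` gives them distinct labels.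
    -- Vertices outside `e₀` are precolored with a placeholder.
    number-e₀ : ∃ λ (c : Fin #V → Fin N) → ∀ {u v} → InE₀ u v → c u ≢ c v
    number-e₀ = greedy (λ v → ¬? (v ∈? edge e₀)) (λ _ → e₀) (λ u∉e _ (_ , u∈e , _) → contradiction u∈e u∉e) (λ _ → 0) few
      where
      open Greedy InE₀? (λ (u≢v , u∈e , v∈e) → u≢v ∘ sym , v∈e , u∈e) (λ (v≢v , _) → v≢v refl)
      open ≤-Reasoning
      earlier? : ∀ v u → Dec (InE₀ v u × (¬ u ∈ edge e₀ ⊎ 0 ≤ 0))
      earlier? v u = InE₀? v u ×-dec (¬? (u ∈? edge e₀) ⊎-dec 0 ≤? 0)
      few : ∀ v → ¬ ¬ v ∈ edge e₀ → # (earlier? v) < N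
      few v ¬v∉e = begin-strict
        # (earlier? v)           <⟨ sum-mono-< (λ u → 𝟙-mono (earlier? v u) (u ∈? edge e₀) λ ((_ , _ , u∈e) , _) → u∈e) v
                                      (𝟙-< (earlier? v v) (v ∈? edge e₀) (λ ((v≢v , _) , _) → v≢v refl)
                                        (decidable-stable (v ∈? edge e₀) ¬v∉e)) ⟩
        sum (λ u → I u e₀)       ≡⟨ edge-size e₀ ⟩
        N                        ∎

    -- The line through the point `e₀` represents the parallel class of `v`; if `v` is no line, `v`
    -- itself is a dummy value.
    direction : ∀ v → ∃ λ w → d v ≡ k → Parallel v e₀ w
    direction v with d v ≟ k
    ... | yes dv≡k = let w , w∥v = playfair-exists dv≡k e₀ in w , λ _ → w∥v
    ... | no  dv≢k = v , λ dv≡k → contradiction dv≡k dv≢k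

    directionColor : Fin #V → Fin N
    directionColor v = proj₁ number-e₀ (proj₁ (direction v))

    -- Equal colors mean a common representative `u`. Both lines are then the parallel to `u`
    -- through their common point `e`, hence equal.
    directionColor-proper : ∀ {x y} → d x ≡ k → d y ≡ k → Adj x y → directionColor x ≢ directionColor y
    directionColor-proper {x} {y} dx≡k dy≡k (x≢y , e , x∈e , y∈e) same
      with direction x | direction y
    ... | u , par-x | w , par-y with par-x dx≡k | par-y dy≡k | u ≟ᶠ w
    ...   | du≡k , u∈e₀ , ¬xu | _ , w∈e₀ , _   | no u≢w  = proj₂ number-e₀ (u≢w , u∈e₀ , w∈e₀) same
    ...   | du≡k , u∈e₀ , ¬xu | _ , _    , ¬yu | yes refl =
      x≢y (playfair-unique du≡k (dx≡k , x∈e , ¬xu ∘ Adj-sym) (dy≡k , y∈e , ¬yu ∘ Adj-sym))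

    colored : Colored
    colored = greedy (λ v → d v ≟ k) directionColor directionColor-proper d few
      where
      open Greedy Adj? Adj-sym Adj-irrefl
      -- The precolored lines are upper neighbors because no degree exceeds `k`, and a bad vertex
      -- would itself have degree `k`.
      few : ∀ v → d v ≢ k → # (λ u → Adj? v u ×-dec (d u ≟ k ⊎-dec d v ≤? d u)) < N
      few v dv≢k = ≤-<-trans
        (sum-mono-≤ λ u → 𝟙-mono (Adj? v u ×-dec (d u ≟ k ⊎-dec d v ≤? d u)) (upper? v u) λ where
          (a , inj₁ du≡k)  → a , ≤-trans (d≤k v) (≤-reflexive (sym du≡k))
          (a , inj₂ dv≤du) → a , dv≤du)
        (≰⇒> λ bad → dv≢k (bad⇒same-degree v₀ bad k*k≡N))

  colored : Colored
  colored with any? Bad?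
  ... | no  none = colorByRank d id λ bad → contradiction (_ , bad) none
  ... | yes (v₀ , bad₀) with any? (λ w → (d w ≟ d v₀) ×-dec ¬? (Bad? w))
  ...   | yes (w , dw≡k , good) =
    AroundGoodVertex.colored w (trans (cong (λ x → x * x) dw≡k) (bad⇒d*d≡N bad₀)) good
  ...   | no  none =
    AffinePlane.colored v₀ bad₀ λ v dv≡k → decidable-stable (Bad? v) λ good → none (v , dv≡k , good)

-- The lower bound, and the chromatic number

#E≤#colors : (H : Hypergraph) → Fin (#E H) → Uniform H (#E H) → ∀ j → Colorable H j → #E H ≤ j
#E≤#colors H e uniform j (f , proper) = begin
  #E H                                                      ≡⟨ uniform e ⟨
  ∣ edge e ∣                                                ≡⟨ ∣ edge e ∣≡# ⟩
  -- Pairs of a vertex of `e` and its color are counted: every vertex occurs in one, and every color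
  -- in at most one.
  # (_∈? edge e)                                            ≤⟨ sum-mono-≤ colored-once ⟩
  sum (λ v → sum λ a → 𝟙 ((v ∈? edge e) ×-dec (f v ≟ᶠ a)))  ≡⟨ ∑-comm (λ v a → 𝟙 ((v ∈? edge e) ×-dec (f v ≟ᶠ a))) ⟩
  sum (λ a → sum λ v → 𝟙 ((v ∈? edge e) ×-dec (f v ≟ᶠ a)))  ≤⟨ sum-mono-≤ (λ a → sum≤1 _ (λ v → 𝟙≤1 ((v ∈? edge e) ×-dec (f v ≟ᶠ a))) (one-per-color a)) ⟩
  sum {j} (λ _ → 1)                                         ≡⟨ sum-ones j ⟩
  j                                                         ∎
  where
  open Hypergraph H using (#V; edge)
  open ≤-Reasoning
  colored-once : ∀ v → 𝟙 (v ∈? edge e) ≤ sum λ a → 𝟙 ((v ∈? edge e) ×-dec (f v ≟ᶠ a))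
  colored-once v = 𝟙-≤ (v ∈? edge e) λ v∈e →
    ≤-trans (≤-reflexive (sym (𝟙-yes ((v ∈? edge e) ×-dec (f v ≟ᶠ f v)) (v∈e , refl)))) (term≤sum _ (f v))
  one-per-color : ∀ a u v → 0 < 𝟙 ((u ∈? edge e) ×-dec (f u ≟ᶠ a)) → 0 < 𝟙 ((v ∈? edge e) ×-dec (f v ≟ᶠ a)) → u ≡ v
  one-per-color a u v p q = decidable-stable (u ≟ᶠ v) λ u≢v →
    let u∈e , fu≡a = 𝟙-positive ((u ∈? edge e) ×-dec (f u ≟ᶠ a)) p
        v∈e , fv≡a = 𝟙-positive ((v ∈? edge e) ×-dec (f v ≟ᶠ a)) q
    in proper u v u≢v e u∈e v∈e (trans fu≡a (sym fv≡a))

theorem3p7 : ∀ (n : ℕ) .{{_ : NonZero n}} (H : Hypergraph) →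
    Linear H → Uniform H n → #E H ≡ n → WeaklyDense H →
    HasChromaticNumber H n
theorem3p7 n H linear uniform refl dense =
  (let c , proper = Colorings.colored H linear uniform dense e₀ in
    c , λ v v′ v≢v′ e v∈e v′∈e → proper (v≢v′ , e , v∈e , v′∈e)) ,
  #E≤#colors H e₀ uniform
  where
  -- Positivity of `n` yields an edge; as there are as many colors as edges, `e₀` also serves as the
  -- default color.
  e₀ : Fin (#E H)
  e₀ = fromℕ< (>-nonZero⁻¹ (#E H))
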